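{- For every integer $n \geq 4$, the collapsibility number of the Vietoris–Rips complex $\mathcal{VR}(\mathbb{I}_n;3)$ of the $n$-dimensional hypercube graph is $8$.
   Context: $\mathbb{I}_n$ is the graph on $\{0,1\}^n$ where two strings are adjacent iff they differ in exactly one coordinate; its graph distance is the Hamming distance. $\mathcal{VR}(X;r)$ is the simplicial complex whose simplices are the finite subsets of $X$ of diameter at most $r$. For a finite simplicial complex $\Delta$, an elementary $d$-collapse removes from $\Delta$ all faces $\tau$ with $\gamma\subseteq\tau\subseteq\sigma$, where $\gamma\in\Delta$ has $|\gamma|\le d$ and $\sigma$ is the unique maximal face of $\Delta$ containing $\gamma$. $\Delta$ is $d$-collapsible if a finite sequence of elementary $d$-collapses reduces $\Delta$ to the void complex. The collapsibility number of $\Delta$ is the minimal $d$ such that $\Delta$ is $d$-collapsible. -}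

module Defs where

open import Data.Nat using (ℕ; zero; suc; _+_; _≤_; _^_; _/_; _%_; _≡ᵇ_)
open import Data.Bool using (Bool; true; false; if_then_else_)
open import Data.Fin using (Fin; toℕ)
open import Data.Fin.Subset using (Subset; _∈_; _⊆_; ∣_∣)
open import Data.Vec using (Vec; []; _∷_; tabulate)
open import Data.Product using (_×_)
open import Relation.Nullary using (¬_)
open import Relation.Binary.PropositionalEquality using (_≡_)
open import Level using (0ℓ) renaming (suc to lsuc)

-- Finite abstract simplicial complexes on the vertex set Fin m.
-- A complex is given by its set of faces (a predicate on subsets of
-- the vertex set); the empty face may or may not belong to it.

Complex : ℕ → Set₁
Complex m = Subset m → Set

IsMaximalFace : ∀ {m} → Complex m → Subset m → Set
IsMaximalFace Δ σ = Δ σ × (∀ τ → Δ τ → σ ⊆ τ → τ ≡ σ)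

IsUniqueMaxFaceContaining : ∀ {m} → Complex m → Subset m → Subset m → Set
IsUniqueMaxFaceContaining Δ γ σ =
  γ ⊆ σ × IsMaximalFace Δ σ × (∀ σ′ → IsMaximalFace Δ σ′ → γ ⊆ σ′ → σ′ ≡ σ)

removeInterval : ∀ {m} → Complex m → Subset m → Subset m → Complex m
removeInterval Δ γ σ τ = Δ τ × ¬ (γ ⊆ τ × τ ⊆ σ)

IsVoid : ∀ {m} → Complex m → Set
IsVoid {m} Δ = ∀ (τ : Subset m) → ¬ Δ τ

data Collapsible {m : ℕ} (d : ℕ) : Complex m → Set₁ where
  done : ∀ {Δ} → IsVoid Δ → Collapsible d Δ
  step : ∀ {Δ} (γ σ : Subset m) →
         Δ γ → ∣ γ ∣ ≤ d → IsUniqueMaxFaceContaining Δ γ σ →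
         Collapsible d (removeInterval Δ γ σ) → Collapsible d Δ

CollapsibilityNumberIs : ∀ {m} → Complex m → ℕ → Set₁
CollapsibilityNumberIs Δ c = Collapsible c Δ × (∀ d → Collapsible d Δ → c ≤ d)

VR : ∀ {m} → (Fin m → Fin m → ℕ) → ℕ → Complex m
VR dist r τ = ∀ i j → i ∈ τ → j ∈ τ → dist i j ≤ r

-- Hypercube I_n: vertex k : Fin (2 ^ n) is identified with the binary
-- string of length n given by its n lowest binary digits (a bijection
-- Fin (2^n) ≅ {0,1}^n); the graph distance is the Hamming distance.

bit : ℕ → ℕ → Bool
bit k zero    = k % 2 ≡ᵇ 1
bit k (suc i) = bit (k / 2) i

toBits : (n : ℕ) → Fin (2 ^ n) → Vec Bool n
toBits n k = tabulate (λ i → bit (toℕ k) (toℕ i))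

differ : Bool → Bool → ℕ
differ true  false = 1
differ false true  = 1
differ _     _     = 0

hamming : ∀ {n} → Vec Bool n → Vec Bool n → ℕ
hamming []       []       = 0
hamming (a ∷ as) (b ∷ bs) = differ a b + hamming as bs

hypercubeDist : (n : ℕ) → Fin (2 ^ n) → Fin (2 ^ n) → ℕ
hypercubeDist n x y = hamming (toBits n x) (toBits n y)

VRHypercube : (n : ℕ) → ℕ → Complex (2 ^ n)
VRHypercube n r = VR (hypercubeDist n) r

module Submission where

-- Upper bound.  Pick vertices one at a time, each in conflict with (at distance
-- ≥ 4 from) some remaining vertex w, recursing into its link and then into its
-- deletion; without conflicts a single collapse finishes.  The picks v₁,v₂,… and
-- conflicts w₁,w₂,… satisfy d(vᵢ,wᵢ) ≥ 4 and d(vⱼ,vᵢ), d(vⱼ,wᵢ) ≤ 3 for j < i, so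
-- (v₁,w₁),…,(v_k,w_k),(w_k,v_k),…,(w₁,v₁) is a skew system of pairs of bit strings:
-- each pair is at distance ≥ 4, and the first entry of any pair is at distance ≤ 3
-- from the second entry of any later pair.
-- A skew system for the threshold t has at most 2^t members.  Take generic linear
-- forms pᵢ in the ring K[y₁,…,y_t]/(y₁²,…,y_t²) over a domain K of characteristic 2
-- and let u(a) be the product of (1 + pᵢ) over the i with aᵢ = 1.  As pᵢ² = 0,
-- u(a) u(b) is the product over the i with aᵢ ≠ bᵢ, and its coefficient at y₁⋯y_t
-- vanishes iff d(a,b) < t.  These coefficients form a triangular matrix of rank at
-- most 2^t.  For t = 4 this gives 2k ≤ 16.
-- Lower bound.  A 4-dimensional subcube spans the boundary of the 8-dimensional
-- cross-polytope, on which no collapse at a face with fewer than 8 vertices can act.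

open import Defs
open import Algebra.Bundles using (CommutativeRing)
import Algebra.Construct.Pointwise as Pointwise
import Algebra.Properties.CommutativeMonoid.Sum as CommutativeMonoidSum
import Algebra.Properties.Semiring.Sum as SemiringSum
import Algebra.Solver.Ring.NaturalCoefficients.Default as Solver
open import Data.Bool using (Bool; true; false; not; if_then_else_; _xor_; _∧_)
import Data.Bool.Properties as Bool
open import Data.Fin as Fin using (Fin; toℕ; fromℕ<)
open import Data.Fin.Properties using (any?; all?; toℕ-fromℕ<; toℕ<n; toℕ-injective)
open import Data.Fin.Subset using (Subset; _∈_; _∉_; _⊆_; _⊂_; _⊃_; ∣_∣; _∪_; _∩_; _-_; ⁅_⁆; ⊤; ⊥)
open import Data.Fin.Subset.Induction using (⊃-wellFounded)
open import Data.Fin.Subset.Properties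
open import Data.List as List using (List; []; _∷_; length)
open import Data.List.Properties using (length-map; length-++; length-tabulate)
open import Data.List.Relation.Unary.All as All using (All; []; _∷_)
import Data.List.Relation.Unary.All.Properties as All
open import Data.List.Relation.Unary.AllPairs as AllPairs using (AllPairs; []; _∷_)
import Data.List.Relation.Unary.AllPairs.Properties as AllPairs
open import Data.List.Relation.Unary.Unique.Propositional using (Unique)
import Data.List.Relation.Unary.Unique.Propositional.Properties as Unique
open import Data.Nat as ℕ using (ℕ; zero; suc; z≤n; s≤s; _≤_; _<_; _≤?_; _<?_)
open import Data.Nat.DivMod using (m<n*o⇒m/o<n)
open import Data.Nat.Induction using (<-wellFounded)
import Data.Nat.Properties as ℕ
open import Data.Product using (_×_; _,_; proj₁; proj₂; ∃; ∃₂; map)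
open import Data.Sum using (_⊎_; inj₁; inj₂)
open import Data.Vec as Vec using (Vec; []; _∷_; zipWith; replicate; tabulate)
open import Data.Vec.Functional using (Vector; removeAt; _++_)
open import Data.Vec.Properties using (lookup⇒[]=; []=⇒lookup; lookup∘tabulate)
open import Function using (_∘_; _⇔_; mk⇔; case_of_; module Equivalence)
open import Induction.WellFounded using (Acc; acc)
open import Level using (0ℓ)
open import Relation.Binary.PropositionalEquality as ≡ using (_≡_)
import Relation.Binary.Reasoning.Setoid as SetoidReasoning
open import Relation.Nullary using (¬_; Dec; yes; no; does; contradiction)
open import Relation.Nullary.Decidable
  using (_×-dec_; _⊎-dec_; _→-dec_; ¬?; decidable-stable; dec-true; from-yes; ¬¬-excluded-middle)

-- Power series over a domain of characteristic 2

module PowerSeries (R : CommutativeRing 0ℓ 0ℓ) where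
  open CommutativeRing R
  open Solver commutativeSemiring using (solve; _:=_; _:+_; _:*_)
  open SetoidReasoning setoid

  Series : Set
  Series = ℕ → Carrier

  infix 4 _≋_
  _≋_ : Series → Series → Set
  f ≋ g = ∀ k → f k ≈ g k

  infixl 7 _⊛_
  _⊛_ : Series → Series → Series
  (f ⊛ g) zero    = f 0 * g 0
  (f ⊛ g) (suc k) = f 0 * g (suc k) + ((f ∘ suc) ⊛ g) k

  _⊞_ : Series → Series → Series
  (f ⊞ g) k = f k + g k

  const : Carrier → Series
  const c zero    = c
  const c (suc _) = 0#

  ⊛-cong : ∀ {f f′ g g′} → f ≋ f′ → g ≋ g′ → f ⊛ g ≋ f′ ⊛ g′
  ⊛-cong f≋ g≋ zero    = *-cong (f≋ 0) (g≋ 0)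
  ⊛-cong f≋ g≋ (suc k) = +-cong (*-cong (f≋ 0) (g≋ (suc k))) (⊛-cong (f≋ ∘ suc) g≋ k)

  ⊛-distribʳ : ∀ h f g → (f ⊞ g) ⊛ h ≋ (f ⊛ h) ⊞ (g ⊛ h)
  ⊛-distribʳ h f g zero    = distribʳ _ _ _
  ⊛-distribʳ h f g (suc k) = trans (+-congˡ (⊛-distribʳ h (f ∘ suc) (g ∘ suc) k))
    (solve 5 (λ a b c x y → (a :+ b) :* c :+ (x :+ y) := (a :* c :+ x) :+ (b :* c :+ y)) refl _ _ _ _ _)

  -- Splits off the constant term of the second factor, where the definition splits off that of the
  -- first; comparing the two recursions gives commutativity.
  ⊛-tail : ∀ f g k → (f ⊛ g) (suc k) ≈ (f ⊛ (g ∘ suc)) k + f (suc k) * g 0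
  ⊛-tail f g zero    = refl
  ⊛-tail f g (suc k) = trans (+-congˡ (⊛-tail (f ∘ suc) g k)) (sym (+-assoc _ _ _))

  ⊛-comm : ∀ f g → f ⊛ g ≋ g ⊛ f
  ⊛-comm f g zero    = *-comm _ _
  ⊛-comm f g (suc k) = begin
    f 0 * g (suc k) + ((f ∘ suc) ⊛ g) k  ≈⟨ +-comm _ _ ⟩
    ((f ∘ suc) ⊛ g) k + f 0 * g (suc k)  ≈⟨ +-cong (⊛-comm (f ∘ suc) g k) (*-comm _ _) ⟩
    (g ⊛ (f ∘ suc)) k + g (suc k) * f 0  ≈⟨ ⊛-tail g f k ⟨
    (g ⊛ f) (suc k)                      ∎

  ⊛-distribˡ : ∀ f g h → f ⊛ (g ⊞ h) ≋ (f ⊛ g) ⊞ (f ⊛ h)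
  ⊛-distribˡ f g h k = trans (⊛-comm f (g ⊞ h) k)
    (trans (⊛-distribʳ f g h k) (+-cong (⊛-comm g f k) (⊛-comm h f k)))

  ⊛-scaleˡ : ∀ c f g k → ((λ i → c * f i) ⊛ g) k ≈ c * (f ⊛ g) k
  ⊛-scaleˡ c f g zero    = *-assoc _ _ _
  ⊛-scaleˡ c f g (suc k) = trans (+-cong (*-assoc _ _ _) (⊛-scaleˡ c (f ∘ suc) g k)) (sym (distribˡ _ _ _))

  ⊛-assoc : ∀ f g h → (f ⊛ g) ⊛ h ≋ f ⊛ (g ⊛ h)
  ⊛-assoc f g h zero    = *-assoc _ _ _
  ⊛-assoc f g h (suc k) = begin
    f 0 * g 0 * h (suc k) + (((λ i → f 0 * g (suc i)) ⊞ ((f ∘ suc) ⊛ g)) ⊛ h) k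
      ≈⟨ +-congˡ (⊛-distribʳ h _ _ k) ⟩
    f 0 * g 0 * h (suc k) + (((λ i → f 0 * g (suc i)) ⊛ h) k + (((f ∘ suc) ⊛ g) ⊛ h) k)
      ≈⟨ +-congˡ (+-cong (⊛-scaleˡ (f 0) (g ∘ suc) h k) (⊛-assoc (f ∘ suc) g h k)) ⟩
    f 0 * g 0 * h (suc k) + (f 0 * ((g ∘ suc) ⊛ h) k + ((f ∘ suc) ⊛ (g ⊛ h)) k)
      ≈⟨ solve 5 (λ a b c x y → a :* b :* c :+ (a :* x :+ y) := a :* (b :* c :+ x) :+ y) refl _ _ _ _ _ ⟩
    f 0 * (g 0 * h (suc k) + ((g ∘ suc) ⊛ h) k) + ((f ∘ suc) ⊛ (g ⊛ h)) k ∎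

  ⊛-const : ∀ f c k → (f ⊛ const c) k ≈ f k * c
  ⊛-const f c zero    = refl
  ⊛-const f c (suc k) = trans (+-cong (zeroʳ _) (⊛-const (f ∘ suc) c k)) (+-identityˡ _)

  powerSeries : CommutativeRing 0ℓ 0ℓ
  powerSeries = record
    { Carrier = Series ; _≈_ = _≋_ ; _+_ = _⊞_ ; _*_ = _⊛_ ; -_ = λ f k → - f k
    ; 0# = λ _ → 0# ; 1# = const 1#
    ; isCommutativeRing = record
      { isRing = record
        { +-isAbelianGroup = Pointwise.isAbelianGroup ℕ +-isAbelianGroup
        ; *-cong = ⊛-cong
        ; *-assoc = ⊛-assoc
        ; *-identity = (λ f k → trans (⊛-comm (const 1#) f k) (identityʳ f k)) , identityʳ
        ; distrib = ⊛-distribˡ , ⊛-distribʳ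
        }
      ; *-comm = ⊛-comm
      }
    }
    where
    identityʳ : ∀ f → f ⊛ const 1# ≋ f
    identityʳ f k = trans (⊛-const f 1# k) (*-identityʳ (f k))

  ⊛-zeroʳ : ∀ f g k → (∀ l → l ≤ k → g l ≈ 0#) → (f ⊛ g) k ≈ 0#
  ⊛-zeroʳ f g zero    g≈0 = trans (*-congˡ (g≈0 0 z≤n)) (zeroʳ _)
  ⊛-zeroʳ f g (suc k) g≈0 = trans
    (+-cong (trans (*-congˡ (g≈0 (suc k) ℕ.≤-refl)) (zeroʳ _))
            (⊛-zeroʳ (f ∘ suc) g k (λ l l≤k → g≈0 l (ℕ.m≤n⇒m≤1+n l≤k))))
    (+-identityˡ _)

  -- Every other term of the convolution has an index below `i` in `f` or below `j` in `g`.
  ⊛-lowest : ∀ f g i j → (∀ k → k < i → f k ≈ 0#) → (∀ l → l < j → g l ≈ 0#) →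
             (f ⊛ g) (i ℕ.+ j) ≈ f i * g j
  ⊛-lowest f g zero zero    f≈0 g≈0 = refl
  ⊛-lowest f g zero (suc j) f≈0 g≈0 =
    trans (+-congˡ (⊛-zeroʳ (f ∘ suc) g j (λ l l≤j → g≈0 l (s≤s l≤j)))) (+-identityʳ _)
  ⊛-lowest f g (suc i) j    f≈0 g≈0 = trans
    (+-cong (trans (*-congʳ (f≈0 0 (s≤s z≤n))) (zeroˡ _))
            (⊛-lowest (f ∘ suc) g i j (λ k k<i → f≈0 (suc k) (s≤s k<i)) g≈0))
    (+-identityˡ _)

-- Stability replaces a zero test, which power series do not have.
record Domain₂ : Set₁ where
  field
    commutativeRing : CommutativeRing 0ℓ 0ℓ
  open CommutativeRing commutativeRing public
  field
    x+x≈0      : ∀ x → x + x ≈ 0#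
    ≈0-stable  : ∀ x → ¬ ¬ x ≈ 0# → x ≈ 0#
    *-nonzero  : ∀ x y → ¬ x ≈ 0# → ¬ y ≈ 0# → ¬ x * y ≈ 0#

𝔽₂ : Domain₂
𝔽₂ = record
  { commutativeRing = Bool.xor-∧-commutativeRing
  ; x+x≈0 = Bool.xor-same
  ; ≈0-stable = λ x → decidable-stable (x Bool.≟ false)
  ; *-nonzero = nonzero
  }
  where
  nonzero : ∀ x y → ¬ x ≡ false → ¬ y ≡ false → ¬ x ∧ y ≡ false
  nonzero true y _ y≢ = y≢
  nonzero false y x≢ _ = contradiction ≡.refl x≢

infixl 10 _⟦z⟧
_⟦z⟧ : Domain₂ → Domain₂
D ⟦z⟧ = record
  { commutativeRing = powerSeries
  ; x+x≈0 = λ f k → x+x≈0 (f k)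
  ; ≈0-stable = λ f ¬¬0 k → ≈0-stable (f k) (λ fk≉0 → ¬¬0 (λ f≈0 → fk≉0 (f≈0 k)))
  ; *-nonzero = nonzero
  }
  where
  open Domain₂ D
  open PowerSeries commutativeRing
  nonzero : ∀ f g → ¬ f ≋ (λ _ → 0#) → ¬ g ≋ (λ _ → 0#) → ¬ f ⊛ g ≋ (λ _ → 0#)
  nonzero f g f≉0 g≉0 fg≈0 = f≉0 λ i → ≈0-stable (f i) λ fi≉0 →
    g≉0 λ j → ≈0-stable (g j) λ gj≉0 → lowest i j (<-wellFounded (i ℕ.+ j)) fi≉0 gj≉0
    where
    -- Least nonzero coefficients cannot be searched for without a zero test. Induction on `i + j`
    -- replaces the search: smaller pairs are already excluded, so by stability `f` vanishes below
    -- `i` and `g` below `j`.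
    lowest : ∀ i j → Acc _<_ (i ℕ.+ j) → ¬ f i ≈ 0# → ¬ ¬ g j ≈ 0#
    lowest i j (acc rec) fi≉0 gj≉0 = *-nonzero (f i) (g j) fi≉0 gj≉0
      (trans (sym (⊛-lowest f g i j
          (λ k k<i → ≈0-stable (f k) λ fk≉0 → lowest k j (rec (ℕ.+-monoˡ-< j k<i)) fk≉0 gj≉0)
          (λ l l<j → ≈0-stable (g l) λ gl≉0 → lowest i l (rec (ℕ.+-monoʳ-< i l<j)) fi≉0 gl≉0)))
        (fg≈0 (i ℕ.+ j)))

-- Triangular systems of linear forms

module Elimination (D : Domain₂) where
  open Domain₂ D
  open Solver commutativeSemiring using (solve; _:=_; _:+_; _:*_)
  open CommutativeMonoidSum +-commutativeMonoid using (sum; sum-remove; ∑-distrib-+; sum-cong-≋)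
  open SemiringSum semiring using (*-distribˡ-sum)
  open SetoidReasoning setoid

  dot : ∀ {N} → Vector Carrier N → Vector Carrier N → Carrier
  dot u g = sum (λ k → u k * g k)

  dot-zeroˡ : ∀ {N} (u g : Vector Carrier N) → (∀ k → u k ≈ 0#) → dot u g ≈ 0#
  dot-zeroˡ {zero}  u g u≈0 = refl
  dot-zeroˡ {suc N} u g u≈0 = trans
    (+-cong (trans (*-congʳ (u≈0 Fin.zero)) (zeroˡ _)) (dot-zeroˡ (u ∘ Fin.suc) (g ∘ Fin.suc) (u≈0 ∘ Fin.suc)))
    (+-identityˡ _)

  dot-combination : ∀ {N} a b (u v g : Vector Carrier N) →
    dot (λ i → a * u i + b * v i) g ≈ a * dot u g + b * dot v g
  dot-combination a b u v g = begin
    sum (λ i → (a * u i + b * v i) * g i)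
      ≈⟨ sum-cong-≋ (λ i → solve 5 (λ a b u v g → (a :* u :+ b :* v) :* g := a :* (u :* g) :+ b :* (v :* g)) refl a b (u i) (v i) (g i)) ⟩
    sum (λ i → a * (u i * g i) + b * (v i * g i))
      ≈⟨ ∑-distrib-+ (λ i → a * (u i * g i)) (λ i → b * (v i * g i)) ⟩
    sum (λ i → a * (u i * g i)) + sum (λ i → b * (v i * g i))
      ≈⟨ +-cong (*-distribˡ-sum a (λ i → u i * g i)) (*-distribˡ-sum b (λ i → v i * g i)) ⟨
    a * dot u g + b * dot v g ∎

  Triangular : ∀ {N} → List (Vector Carrier N × Vector Carrier N) → Set
  Triangular L = All (λ (u , g) → ¬ dot u g ≈ 0#) L × AllPairs (λ (u , _) (_ , g) → dot u g ≈ 0#) L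

  module _ {N} (k : Fin (suc N)) (u : Vector Carrier (suc N)) where

    -- A pivot step without division: the cross-multiplied combination has `k`-th coordinate
    -- `u k * v k + v k * u k`, which is 0 in characteristic 2.
    eliminate : Vector Carrier (suc N) × Vector Carrier (suc N) → Vector Carrier N × Vector Carrier N
    eliminate (v , g) = removeAt (λ i → u k * v i + v k * u i) k , removeAt g k

    -- Dropping the coordinate `k`, where the combination vanishes, does not change the pairing, and
    -- the summand from `u` pairs to 0 with `h`.
    dot-eliminate : ∀ v w g h → dot u h ≈ 0# →
      dot (proj₁ (eliminate (v , g))) (proj₂ (eliminate (w , h))) ≈ u k * dot v h
    dot-eliminate v w g h uh≈0 = begin
      dot (removeAt c k) (removeAt h k)             ≈⟨ +-identityˡ _ ⟨
      0# + dot (removeAt c k) (removeAt h k)        ≈⟨ +-congʳ (trans (*-congʳ ck≈0) (zeroˡ _)) ⟨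
      c k * h k + dot (removeAt c k) (removeAt h k) ≈⟨ sum-remove {i = k} (λ i → c i * h i) ⟨
      dot c h                                       ≈⟨ dot-combination (u k) (v k) v u h ⟩
      u k * dot v h + v k * dot u h                 ≈⟨ +-congˡ (trans (*-congˡ uh≈0) (zeroʳ _)) ⟩
      u k * dot v h + 0#                            ≈⟨ +-identityʳ _ ⟩
      u k * dot v h                                 ∎
      where
      c : Vector Carrier (suc N)
      c i = u k * v i + v k * u i
      ck≈0 : c k ≈ 0#
      ck≈0 = trans (+-congˡ (*-comm _ _)) (x+x≈0 _)

    eliminate-triangular : ¬ u k ≈ 0# → ∀ L → All (λ (_ , g) → dot u g ≈ 0#) L →
      Triangular L → Triangular (List.map eliminate L)
    eliminate-triangular uk≉0 L zeros (nonzeros , pairs) =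
      All.map⁺ (All.zipWith (λ {(v , g)} (ug≈0 , vg≉0) →
        *-nonzero (u k) (dot v g) uk≉0 vg≉0 ∘ trans (sym (dot-eliminate v v g g ug≈0))) (zeros , nonzeros)) ,
      AllPairs.map⁺ (go zeros pairs)
      where
      R = λ (p q : Vector Carrier (suc N) × Vector Carrier (suc N)) →
        dot (proj₁ (eliminate p)) (proj₂ (eliminate q)) ≈ 0#
      go : ∀ {L} → All (λ (_ , g) → dot u g ≈ 0#) L → AllPairs (λ (u , _) (_ , g) → dot u g ≈ 0#) L → AllPairs R L
      go [] [] = []
      go {(v , g) ∷ _} (_ ∷ zeros) (vs ∷ pairs) =
        All.zipWith (λ {(w , h)} (uh≈0 , vh≈0) →
          trans (dot-eliminate v w g h uh≈0) (trans (*-congˡ vh≈0) (zeroʳ _))) (zeros , vs)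
        ∷ go zeros pairs

  -- The first `u` has a nonzero pairing, hence a nonzero coordinate to pivot on. This coordinate
  -- exists only up to double negation, so a list that is too long is refuted by showing that all
  -- coordinates of `u` vanish.
  triangular-length : ∀ {N} L → Triangular {N} L → length L ≤ N
  triangular-length [] _ = z≤n
  triangular-length {zero} ((u , g) ∷ L) (ug≉0 ∷ _ , _) = contradiction refl ug≉0
  triangular-length {suc N} ((u , g) ∷ L) (ug≉0 ∷ nonzeros , zeros ∷ pairs) =
    decidable-stable (_ ≤? _) λ long → ug≉0 (dot-zeroˡ u g λ k → ≈0-stable (u k) λ uk≉0 →
      long (s≤s (≡.subst (_≤ N) (length-map (eliminate k u) L)
        (triangular-length (List.map (eliminate k u) L)
          (eliminate-triangular k u uk≉0 L zeros (nonzeros , pairs))))))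

-- Square-free polynomials in t variables, as functions on exponent vectors:
-- the ring K[y₁,…,y_t]/(y₁²,…,y_t²).
module SquareFree (D : Domain₂) where
  open Domain₂ D
  open Solver commutativeSemiring using (solve; _:=_; _:+_; _:*_)
  open SetoidReasoning setoid

  infix 4 _≋_
  Poly : ℕ → Set
  Poly t = Vec Bool t → Carrier

  _≋_ : ∀ {t} → Poly t → Poly t → Set
  U ≋ V = ∀ J → U J ≈ V J

  infixl 6 _⊞_
  _⊞_ : ∀ {t} → Poly t → Poly t → Poly t
  (U ⊞ V) J = U J + V J

  one : ∀ {t} → Poly t
  one []          = 1#
  one (true ∷ J)  = 0#
  one (false ∷ J) = one J

  -- multiplication by the linear form Σ z_j y_j
  linear : (ℕ → Carrier) → ∀ {t} → Poly t → Poly t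
  linear z U [] = 0#
  linear z U (false ∷ J) = linear z (U ∘ (false ∷_)) J
  linear z {suc t} U (true ∷ J) = linear z (U ∘ (true ∷_)) J + z t * U (false ∷ J)

  linear-cong : ∀ z {t} {U V : Poly t} → U ≋ V → linear z U ≋ linear z V
  linear-cong z eq [] = refl
  linear-cong z eq (false ∷ J) = linear-cong z (eq ∘ (false ∷_)) J
  linear-cong z eq (true ∷ J) = +-cong (linear-cong z (eq ∘ (true ∷_)) J) (*-congˡ (eq _))

  linear-⊞ : ∀ z {t} (U V : Poly t) → linear z (U ⊞ V) ≋ linear z U ⊞ linear z V
  linear-⊞ z U V [] = sym (+-identityˡ _)
  linear-⊞ z U V (false ∷ J) = linear-⊞ z (U ∘ (false ∷_)) (V ∘ (false ∷_)) J
  linear-⊞ z U V (true ∷ J) = trans (+-congʳ (linear-⊞ z (U ∘ (true ∷_)) (V ∘ (true ∷_)) J))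
    (solve 5 (λ a b z u v → a :+ b :+ z :* (u :+ v) := a :+ z :* u :+ (b :+ z :* v)) refl _ _ _ _ _)

  linear-scale : ∀ z c {t} (U : Poly t) J → linear z (λ J → c * U J) J ≈ c * linear z U J
  linear-scale z c U [] = sym (zeroʳ c)
  linear-scale z c U (false ∷ J) = linear-scale z c (U ∘ (false ∷_)) J
  linear-scale z c U (true ∷ J) = trans (+-congʳ (linear-scale z c (U ∘ (true ∷_)) J))
    (solve 4 (λ c l z u → c :* l :+ z :* (c :* u) := c :* (l :+ z :* u)) refl _ _ _ _)

  -- Separates the first variable and exposes the two mixed terms, which `linear-comm` swaps and
  -- `linear-square` cancels.
  linear-linear : ∀ z w {t} (U : Poly (suc t)) J → linear z (linear w U) (true ∷ J) ≈
    linear z (linear w (U ∘ (true ∷_))) J + w t * linear z (U ∘ (false ∷_)) J + z t * linear w (U ∘ (false ∷_)) J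
  linear-linear z w {t} U J = +-congʳ (trans (linear-⊞ z (linear w (U ∘ (true ∷_))) (λ J → w t * U (false ∷ J)) J)
    (+-congˡ (linear-scale z (w t) (U ∘ (false ∷_)) J)))

  linear-comm : ∀ z w {t} (U : Poly t) → linear z (linear w U) ≋ linear w (linear z U)
  linear-comm z w U [] = refl
  linear-comm z w U (false ∷ J) = linear-comm z w (U ∘ (false ∷_)) J
  linear-comm z w {suc t} U (true ∷ J) = begin
    linear z (linear w U) (true ∷ J) ≈⟨ linear-linear z w U J ⟩
    linear z (linear w U₁) J + w t * linear z U₀ J + z t * linear w U₀ J ≈⟨ +-congʳ (+-congʳ (linear-comm z w U₁ J)) ⟩
    linear w (linear z U₁) J + w t * linear z U₀ J + z t * linear w U₀ J
      ≈⟨ solve 3 (λ a b c → a :+ b :+ c := a :+ c :+ b) refl _ _ _ ⟩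
    linear w (linear z U₁) J + z t * linear w U₀ J + w t * linear z U₀ J ≈⟨ linear-linear w z U J ⟨
    linear w (linear z U) (true ∷ J) ∎
    where
    U₀ = U ∘ (false ∷_)
    U₁ = U ∘ (true ∷_)

  -- The squares of the variables vanish in the ring, and each mixed term occurs twice.
  linear-square : ∀ z {t} (U : Poly t) J → linear z (linear z U) J ≈ 0#
  linear-square z U [] = refl
  linear-square z U (false ∷ J) = linear-square z (U ∘ (false ∷_)) J
  linear-square z {suc t} U (true ∷ J) = begin
    linear z (linear z U) (true ∷ J) ≈⟨ linear-linear z z U J ⟩
    linear z (linear z (U ∘ (true ∷_))) J + x + x ≈⟨ +-assoc _ _ _ ⟩
    linear z (linear z (U ∘ (true ∷_))) J + (x + x) ≈⟨ +-cong (linear-square z (U ∘ (true ∷_)) J) (x+x≈0 x) ⟩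
    0# + 0# ≈⟨ +-identityˡ 0# ⟩
    0# ∎
    where x = z t * linear z (U ∘ (false ∷_)) J

  -- the coefficient of y₁⋯y_t in the product U V
  ⟨_,_⟩ : ∀ {t} → Poly t → Poly t → Carrier
  ⟨_,_⟩ {zero}  U V = U [] * V []
  ⟨_,_⟩ {suc t} U V = ⟨ U ∘ (false ∷_) , V ∘ (true ∷_) ⟩ + ⟨ U ∘ (true ∷_) , V ∘ (false ∷_) ⟩

  ⟨⟩-cong : ∀ {t} {U U′ V V′ : Poly t} → U ≋ U′ → V ≋ V′ → ⟨ U , V ⟩ ≈ ⟨ U′ , V′ ⟩
  ⟨⟩-cong {zero}  eq eq′ = *-cong (eq []) (eq′ [])
  ⟨⟩-cong {suc t} eq eq′ = +-cong (⟨⟩-cong (eq ∘ (false ∷_)) (eq′ ∘ (true ∷_))) (⟨⟩-cong (eq ∘ (true ∷_)) (eq′ ∘ (false ∷_)))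

  ⟨⟩-⊞ˡ : ∀ {t} (U U′ V : Poly t) → ⟨ U ⊞ U′ , V ⟩ ≈ ⟨ U , V ⟩ + ⟨ U′ , V ⟩
  ⟨⟩-⊞ˡ {zero}  U U′ V = distribʳ _ _ _
  ⟨⟩-⊞ˡ {suc t} U U′ V = trans (+-cong (⟨⟩-⊞ˡ (U ∘ (false ∷_)) _ _) (⟨⟩-⊞ˡ (U ∘ (true ∷_)) _ _))
    (solve 4 (λ a b c d → a :+ b :+ (c :+ d) := a :+ c :+ (b :+ d)) refl _ _ _ _)

  ⟨⟩-scaleˡ : ∀ {t} c (U V : Poly t) → ⟨ (λ J → c * U J) , V ⟩ ≈ c * ⟨ U , V ⟩
  ⟨⟩-scaleˡ {zero}  c U V = *-assoc _ _ _
  ⟨⟩-scaleˡ {suc t} c U V = trans (+-cong (⟨⟩-scaleˡ c (U ∘ (false ∷_)) _) (⟨⟩-scaleˡ c (U ∘ (true ∷_)) _)) (sym (distribˡ _ _ _))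

  ⟨⟩-comm : ∀ {t} (U V : Poly t) → ⟨ U , V ⟩ ≈ ⟨ V , U ⟩
  ⟨⟩-comm {zero}  U V = *-comm _ _
  ⟨⟩-comm {suc t} U V = trans (+-comm _ _) (+-cong (⟨⟩-comm (U ∘ (true ∷_)) _) (⟨⟩-comm (U ∘ (false ∷_)) _))

  ⟨⟩-⊞ʳ : ∀ {t} (U V V′ : Poly t) → ⟨ U , V ⊞ V′ ⟩ ≈ ⟨ U , V ⟩ + ⟨ U , V′ ⟩
  ⟨⟩-⊞ʳ U V V′ = trans (⟨⟩-comm U _) (trans (⟨⟩-⊞ˡ V V′ U) (+-cong (⟨⟩-comm V U) (⟨⟩-comm V′ U)))

  ⟨⟩-scaleʳ : ∀ {t} c (U V : Poly t) → ⟨ U , (λ J → c * V J) ⟩ ≈ c * ⟨ U , V ⟩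
  ⟨⟩-scaleʳ c U V = trans (⟨⟩-comm U _) (trans (⟨⟩-scaleˡ c V U) (*-congˡ (⟨⟩-comm V U)))

  -- Both sides are the top coefficient of `p U V`, where `p` is the linear form of `z`.
  linear-selfAdjoint : ∀ z {t} (U V : Poly t) → ⟨ linear z U , V ⟩ ≈ ⟨ U , linear z V ⟩
  linear-selfAdjoint z {zero} U V = trans (zeroˡ _) (sym (zeroʳ _))
  linear-selfAdjoint z {suc t} U V = begin
    ⟨ linear z U₀ , V₁ ⟩ + ⟨ linear z U₁ ⊞ (λ J → z t * U₀ J) , V₀ ⟩
      ≈⟨ +-congˡ (trans (⟨⟩-⊞ˡ (linear z U₁) _ V₀) (+-congˡ (⟨⟩-scaleˡ (z t) U₀ V₀))) ⟩
    ⟨ linear z U₀ , V₁ ⟩ + (⟨ linear z U₁ , V₀ ⟩ + z t * ⟨ U₀ , V₀ ⟩)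
      ≈⟨ +-cong (linear-selfAdjoint z U₀ V₁) (+-congʳ (linear-selfAdjoint z U₁ V₀)) ⟩
    ⟨ U₀ , linear z V₁ ⟩ + (⟨ U₁ , linear z V₀ ⟩ + z t * ⟨ U₀ , V₀ ⟩)
      ≈⟨ solve 3 (λ a b c → a :+ (b :+ c) := (a :+ c) :+ b) refl _ _ _ ⟩
    (⟨ U₀ , linear z V₁ ⟩ + z t * ⟨ U₀ , V₀ ⟩) + ⟨ U₁ , linear z V₀ ⟩
      ≈⟨ +-congʳ (trans (⟨⟩-⊞ʳ U₀ (linear z V₁) _) (+-congˡ (⟨⟩-scaleʳ (z t) U₀ V₀))) ⟨
    ⟨ U₀ , linear z V₁ ⊞ (λ J → z t * V₀ J) ⟩ + ⟨ U₁ , linear z V₀ ⟩ ∎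
    where
    U₀ = U ∘ (false ∷_)
    U₁ = U ∘ (true ∷_)
    V₀ = V ∘ (false ∷_)
    V₁ = V ∘ (true ∷_)

  -- Multiplication by `1 + p` if the bit is set, with `p` the linear form of `z`; `product` thus
  -- multiplies by u(a).
  factor : (ℕ → Carrier) → Bool → ∀ {t} → Poly t → Poly t
  factor z false U = U
  factor z true  U = U ⊞ linear z U

  factor-cong : ∀ z b {t} {U V : Poly t} → U ≋ V → factor z b U ≋ factor z b V
  factor-cong z false eq = eq
  factor-cong z true  eq J = +-cong (eq J) (linear-cong z eq J)

  factor-comm : ∀ z w b c {t} (U : Poly t) → factor z b (factor w c U) ≋ factor w c (factor z b U)
  factor-comm z w false c U J = refl
  factor-comm z w true false U J = refl
  factor-comm z w true true U J = begin
    U J + linear w U J + linear z (U ⊞ linear w U) J ≈⟨ +-congˡ (linear-⊞ z U _ J) ⟩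
    U J + linear w U J + (linear z U J + linear z (linear w U) J)
      ≈⟨ solve 4 (λ a b c d → a :+ b :+ (c :+ d) := a :+ c :+ (b :+ d)) refl _ _ _ _ ⟩
    U J + linear z U J + (linear w U J + linear z (linear w U) J) ≈⟨ +-congˡ (+-congˡ (linear-comm z w U J)) ⟩
    U J + linear z U J + (linear w U J + linear w (linear z U) J) ≈⟨ +-congˡ (linear-⊞ w U _ J) ⟨
    U J + linear z U J + linear w (U ⊞ linear z U) J ∎

  factor-involutive : ∀ z {t} (U : Poly t) → factor z true (factor z true U) ≋ U
  factor-involutive z U J = begin
    U J + linear z U J + linear z (U ⊞ linear z U) J ≈⟨ +-congˡ (linear-⊞ z U _ J) ⟩
    U J + linear z U J + (linear z U J + linear z (linear z U) J) ≈⟨ +-congˡ (+-congˡ (linear-square z U J)) ⟩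
    U J + linear z U J + (linear z U J + 0#) ≈⟨ +-congˡ (+-identityʳ _) ⟩
    U J + linear z U J + linear z U J ≈⟨ +-assoc _ _ _ ⟩
    U J + (linear z U J + linear z U J) ≈⟨ +-congˡ (x+x≈0 _) ⟩
    U J + 0# ≈⟨ +-identityʳ _ ⟩
    U J ∎

  -- Multiplication by `1 + p` is self-adjoint and squares to the identity, so the two bits combine
  -- by `xor`.
  factor-adjoint : ∀ z b c {t} (U V : Poly t) → ⟨ factor z b U , factor z c V ⟩ ≈ ⟨ factor z (b xor c) U , V ⟩
  factor-adjoint z false false U V = refl
  factor-adjoint z true  false U V = refl
  factor-adjoint z b true U V = trans (move (factor z b U)) (⟨⟩-cong (merge b) (λ _ → refl))
    where
    move : ∀ W → ⟨ W , factor z true V ⟩ ≈ ⟨ factor z true W , V ⟩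
    move W = begin
      ⟨ W , V ⊞ linear z V ⟩ ≈⟨ ⟨⟩-⊞ʳ W V _ ⟩
      ⟨ W , V ⟩ + ⟨ W , linear z V ⟩ ≈⟨ +-congˡ (linear-selfAdjoint z W V) ⟨
      ⟨ W , V ⟩ + ⟨ linear z W , V ⟩ ≈⟨ ⟨⟩-⊞ˡ W _ V ⟨
      ⟨ W ⊞ linear z W , V ⟩ ∎
    merge : ∀ b → factor z true (factor z b U) ≋ factor z (b xor true) U
    merge false J = refl
    merge true = factor-involutive z U

  product : ∀ {n} → Vec (ℕ → Carrier) n → Vec Bool n → ∀ {t} → Poly t → Poly t
  product []       []       U = U
  product (z ∷ zs) (b ∷ bs) U = factor z b (product zs bs U)

  product-cong : ∀ {n} (zs : Vec (ℕ → Carrier) n) bs {t} {U V : Poly t} → U ≋ V → product zs bs U ≋ product zs bs V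
  product-cong []       []       eq = eq
  product-cong (z ∷ zs) (b ∷ bs) eq = factor-cong z b (product-cong zs bs eq)

  product-factor : ∀ {n} (zs : Vec (ℕ → Carrier) n) bs z b {t} (U : Poly t) →
    product zs bs (factor z b U) ≋ factor z b (product zs bs U)
  product-factor []       []       z b U J = refl
  product-factor (w ∷ zs) (c ∷ bs) z b U J =
    trans (factor-cong w c (product-factor zs bs z b U) J) (factor-comm w z c b _ J)

  -- Once all factors are on one side, those of coordinates set in both strings cancel, and exactly
  -- the coordinates where the strings differ remain.
  product-adjoint : ∀ {n} (zs : Vec (ℕ → Carrier) n) as bs {t} (U V : Poly t) →
    ⟨ product zs as U , product zs bs V ⟩ ≈ ⟨ product zs (zipWith _xor_ as bs) U , V ⟩
  product-adjoint []       []       []       U V = refl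
  product-adjoint (z ∷ zs) (a ∷ as) (b ∷ bs) U V = begin
    ⟨ factor z a (product zs as U) , factor z b (product zs bs V) ⟩
      ≈⟨ factor-adjoint z a b (product zs as U) (product zs bs V) ⟩
    ⟨ factor z (a xor b) (product zs as U) , product zs bs V ⟩
      -- The factor is moved onto `U`, so that the induction hypothesis, which holds for every `U`,
      -- applies.
      ≈⟨ ⟨⟩-cong (product-factor zs as z (a xor b) U) (λ _ → refl) ⟨
    ⟨ product zs as (factor z (a xor b) U) , product zs bs V ⟩
      ≈⟨ product-adjoint zs as bs _ V ⟩
    ⟨ product zs (zipWith _xor_ as bs) (factor z (a xor b) U) , V ⟩
      ≈⟨ ⟨⟩-cong (product-factor zs (zipWith _xor_ as bs) z (a xor b) U) (λ _ → refl) ⟩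
    ⟨ factor z (a xor b) (product zs (zipWith _xor_ as bs) U) , V ⟩ ∎

  ⟨⟩-one : ∀ {t} (U : Poly t) → ⟨ U , one ⟩ ≈ U (replicate t true)
  ⟨⟩-one {zero}  U = *-identityʳ _
  ⟨⟩-one {suc t} U = trans (+-cong (zero-right (U ∘ (false ∷_))) (⟨⟩-one (U ∘ (true ∷_)))) (+-identityˡ _)
    where
    zero-right : ∀ {t} (U : Poly t) → ⟨ U , (λ _ → 0#) ⟩ ≈ 0#
    zero-right {zero}  U = zeroʳ _
    zero-right {suc t} U = trans (+-cong (zero-right (U ∘ (false ∷_))) (zero-right (U ∘ (true ∷_)))) (+-identityˡ _)

  one-degree : ∀ {t} (J : Vec Bool t) → 0 < ∣ J ∣ → one J ≈ 0#
  one-degree (true ∷ J)  _ = refl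
  one-degree (false ∷ J) 0< = one-degree J 0<

  -- A linear form raises the degree by one: the coefficient at `J` is a combination of coefficients
  -- at exponents with one bit of `J` cleared.
  linear-degree : ∀ z {t} (U : Poly t) J → (∀ J′ → ∣ J ∣ ≤ suc ∣ J′ ∣ → U J′ ≈ 0#) → linear z U J ≈ 0#
  linear-degree z U []          vanish = refl
  linear-degree z U (false ∷ J) vanish = linear-degree z (U ∘ (false ∷_)) J (λ J′ → vanish (false ∷ J′))
  linear-degree z U (true ∷ J)  vanish = trans
    (+-cong (linear-degree z (U ∘ (true ∷_)) J (λ J′ le → vanish (true ∷ J′) (s≤s le)))
            (trans (*-congˡ (vanish (false ∷ J) ℕ.≤-refl)) (zeroʳ _)))
    (+-identityˡ _)

  -- Each set bit of `e` contributes one factor of degree 1, so the product has degree at most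
  -- `∣ e ∣`.
  product-degree : ∀ {n} (zs : Vec (ℕ → Carrier) n) e {t} (J : Vec Bool t) → ∣ e ∣ < ∣ J ∣ → product zs e one J ≈ 0#
  product-degree []       []          J lt = one-degree J lt
  product-degree (z ∷ zs) (false ∷ e) J lt = product-degree zs e J lt
  product-degree (z ∷ zs) (true ∷ e)  J lt = trans
    (+-cong (product-degree zs e J (ℕ.<-trans ℕ.≤-refl lt))
            (linear-degree z _ J (λ J′ le → product-degree zs e J′ (ℕ.≤-pred (ℕ.<-≤-trans lt le)))))
    (+-identityˡ _)

-- Generic linear forms

-- All degrees up to `∣ e ∣` are covered, since the strings of a pair may be further apart than the
-- threshold.
Generic : (D : Domain₂) → ∀ {n} → Vec (ℕ → Domain₂.Carrier D) n → Set
Generic D zs = ∀ e {t} (J : Vec Bool t) → ∣ J ∣ ≤ ∣ e ∣ →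
  ¬ (Domain₂._≈_ D (SquareFree.product D zs e (SquareFree.one D) J) (Domain₂.0# D))

-- The new coordinate gets a new variable Z and the linear form Σ Z^(j+1) y_j; as the
-- exponents are positive and distinct, the coefficients of the product with the new
-- factor, as polynomials in Z, display the coefficients of the old product.
module Extension (D : Domain₂) where
  private
    module K = Domain₂ D
    module P = Domain₂ (D ⟦z⟧)
  open PowerSeries K.commutativeRing using (const; ⊛-const)
  open SquareFree using (linear; one; product)

  infix 4 _≈ᴾ_
  _≈ᴾ_ = P._≈_

  Z : ℕ → P.Carrier
  Z j k = if k ℕ.≡ᵇ suc j then K.1# else K.0#

  const-+ : ∀ a b → const (a K.+ b) ≈ᴾ const a P.+ const b
  const-+ a b zero    = K.refl
  const-+ a b (suc k) = K.sym (K.+-identityˡ _)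

  const-* : ∀ a b → const (a K.* b) ≈ᴾ const a P.* const b
  const-* a b zero    = K.refl
  const-* a b (suc k) = K.sym (K.trans (⊛-const (const a) b (suc k)) (K.zeroˡ b))

  const-0 : const K.0# ≈ᴾ P.0#
  const-0 zero    = K.refl
  const-0 (suc k) = K.refl

  const-cong : ∀ {a b} → a K.≈ b → const a ≈ᴾ const b
  const-cong eq zero    = eq
  const-cong eq (suc k) = K.refl

  one-const : ∀ {t} (J : Vec Bool t) → one (D ⟦z⟧) J ≈ᴾ const (one D J)
  one-const []          = P.refl
  one-const (true ∷ J)  = P.sym const-0
  one-const (false ∷ J) = one-const J

  Constant : ∀ {t} → (Vec Bool t → P.Carrier) → (Vec Bool t → K.Carrier) → Set
  Constant U V = ∀ J → U J ≈ᴾ const (V J)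

  linear-const : ∀ z {t} (U : Vec Bool t → P.Carrier) (V : Vec Bool t → K.Carrier) → Constant U V →
    ∀ J → linear (D ⟦z⟧) (const ∘ z) U J ≈ᴾ const (linear D z V J)
  linear-const z U V eq []          = P.sym const-0
  linear-const z U V eq (false ∷ J) = linear-const z (U ∘ (false ∷_)) (V ∘ (false ∷_)) (eq ∘ (false ∷_)) J
  linear-const z {suc t} U V eq (true ∷ J)  =
    P.trans (P.+-cong (linear-const z (U ∘ (true ∷_)) (V ∘ (true ∷_)) (eq ∘ (true ∷_)) J)
                      (P.trans (P.*-congˡ {x = const (z t)} (eq (false ∷ J))) (P.sym (const-* (z t) (V (false ∷ J))))))
            (P.sym (const-+ _ _))

  product-const : ∀ {n} (zs : Vec (ℕ → K.Carrier) n) e {t} (J : Vec Bool t) →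
    product (D ⟦z⟧) (Vec.map (λ z → const ∘ z) zs) e (one (D ⟦z⟧)) J ≈ᴾ const (product D zs e (one D) J)
  product-const []       []          J = one-const J
  product-const (z ∷ zs) (false ∷ e) J = product-const zs e J
  product-const (z ∷ zs) (true ∷ e)  J = P.trans
    (P.+-cong (product-const zs e J) (linear-const z _ (product D zs e (one D)) (product-const zs e) J))
    (P.sym (const-+ _ _))

  linear-Z-true : ∀ {t} (U : Vec Bool (suc t) → P.Carrier) (V : Vec Bool (suc t) → K.Carrier) → Constant U V → ∀ J k →
    linear (D ⟦z⟧) Z U (true ∷ J) k K.≈ linear (D ⟦z⟧) Z (U ∘ (true ∷_)) J k K.+ Z t k K.* V (false ∷ J)
  linear-Z-true {t} U V eq J k = K.+-congˡ
    (K.trans (P.*-congˡ {x = Z t} (eq (false ∷ J)) k) (⊛-const (Z t) (V (false ∷ J)) k))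

  Z-diagonal : ∀ t → Z t (suc t) ≡ K.1#
  Z-diagonal zero    = ≡.refl
  Z-diagonal (suc t) = Z-diagonal t

  Z-above : ∀ t k → suc t < k → Z t k ≡ K.0#
  Z-above zero    (suc (suc k)) _ = ≡.refl
  Z-above (suc t) (suc k) (s≤s lt) = Z-above t k lt
  Z-above zero (suc zero) (s≤s ())

  linear-Z-zero : ∀ {t} (U : Vec Bool t → P.Carrier) (V : Vec Bool t → K.Carrier) → Constant U V →
    ∀ J → linear (D ⟦z⟧) Z U J 0 K.≈ K.0#
  linear-Z-zero U V eq []          = K.refl
  linear-Z-zero U V eq (false ∷ J) = linear-Z-zero (U ∘ (false ∷_)) (V ∘ (false ∷_)) (eq ∘ (false ∷_)) J
  linear-Z-zero U V eq (true ∷ J)  = K.trans (linear-Z-true U V eq J 0)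
    (K.trans (K.+-cong (linear-Z-zero (U ∘ (true ∷_)) (V ∘ (true ∷_)) (eq ∘ (true ∷_)) J) (K.zeroˡ _)) (K.+-identityˡ _))

  -- In `t` variables only the exponents 1,...,t of the new variable occur.
  linear-Z-above : ∀ {t} (U : Vec Bool t → P.Carrier) (V : Vec Bool t → K.Carrier) → Constant U V →
    ∀ J k → t < k → linear (D ⟦z⟧) Z U J k K.≈ K.0#
  linear-Z-above U V eq []          k _ = K.refl
  linear-Z-above U V eq (false ∷ J) k lt =
    linear-Z-above (U ∘ (false ∷_)) (V ∘ (false ∷_)) (eq ∘ (false ∷_)) J k (ℕ.<-trans ℕ.≤-refl lt)
  linear-Z-above {suc t} U V eq (true ∷ J) k lt = K.trans (linear-Z-true U V eq J k)
    (K.trans (K.+-cong (linear-Z-above (U ∘ (true ∷_)) (V ∘ (true ∷_)) (eq ∘ (true ∷_)) J k (ℕ.<-trans ℕ.≤-refl lt))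
                       (K.trans (K.*-congʳ (K.reflexive (Z-above t k lt))) (K.zeroˡ _)))
             (K.+-identityˡ _))

  -- `J⁻` clears the first set bit of `J`. That bit carries the highest power of the new variable,
  -- and the later bits carry strictly lower ones, so nothing else contributes to its coefficient.
  linear-Z-coefficient : ∀ {t} (U : Vec Bool t → P.Carrier) (V : Vec Bool t → K.Carrier) → Constant U V →
    ∀ J → 0 < ∣ J ∣ → ∃₂ λ k J⁻ → ∣ J ∣ ≡ suc ∣ J⁻ ∣ × linear (D ⟦z⟧) Z U J (suc k) K.≈ V J⁻
  linear-Z-coefficient U V eq (false ∷ J) 0< =
    let k , J⁻ , size , coeff = linear-Z-coefficient (U ∘ (false ∷_)) (V ∘ (false ∷_)) (eq ∘ (false ∷_)) J 0<
    in k , false ∷ J⁻ , size , coeff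
  linear-Z-coefficient {suc t} U V eq (true ∷ J) _ = t , false ∷ J , ≡.refl ,
    K.trans (linear-Z-true U V eq J (suc t))
      (K.trans (K.+-cong (linear-Z-above (U ∘ (true ∷_)) (V ∘ (true ∷_)) (eq ∘ (true ∷_)) J (suc t) ℕ.≤-refl)
                         (K.trans (K.*-congʳ (K.reflexive (Z-diagonal t))) (K.*-identityˡ _)))
               (K.+-identityˡ _))

  generic-extend : ∀ {n} (zs : Vec (ℕ → K.Carrier) n) → Generic D zs → Generic (D ⟦z⟧) (Z ∷ Vec.map (λ z → const ∘ z) zs)
  generic-extend zs gen (false ∷ e) J J≤e ≈0 =
    gen e J J≤e (K.trans (K.sym (product-const zs e J 0)) (≈0 0))
  generic-extend zs gen (true ∷ e) J J≤e ≈0 with ∣ J ∣ ≤? ∣ e ∣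
  -- The constant term in the new variable is the old coefficient at `J`.
  ... | yes J≤ = gen e J J≤ (K.trans (K.sym (K.trans
        (K.+-cong (product-const zs e J 0) (linear-Z-zero _ (product D zs e (one D)) (product-const zs e) J)) (K.+-identityʳ _))) (≈0 0))
  -- Here `∣ J ∣` is `suc ∣ e ∣`, and a positive power of the new variable displays the old
  -- coefficient at `J⁻`, of size `∣ e ∣`.
  ... | no J≰ =
    let k , J⁻ , size , coeff = linear-Z-coefficient _ (product D zs e (one D)) (product-const zs e) J (ℕ.≤-<-trans z≤n (ℕ.≰⇒> J≰)) in
    gen e J⁻ (ℕ.≤-pred (≡.subst (_≤ suc ∣ e ∣) size J≤e))
      (K.trans (K.sym (K.trans (K.+-cong (product-const zs e J (suc k)) coeff) (K.+-identityˡ _))) (≈0 (suc k)))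


generic : ∀ n → ∃₂ λ D (zs : Vec (ℕ → Domain₂.Carrier D) n) → Generic D zs
generic zero    = 𝔽₂ , [] , λ { [] J J≤0 → one-nonzero J J≤0 }
  where
  one-nonzero : ∀ {t} (J : Vec Bool t) → ∣ J ∣ ≤ 0 → ¬ SquareFree.one 𝔽₂ J ≡ false
  one-nonzero [] _ = λ ()
  one-nonzero (false ∷ J) le = one-nonzero J le
generic (suc n) =
  let D , zs , gen = generic n in
  D ⟦z⟧ , Extension.Z D ∷ Vec.map (λ z → PowerSeries.const (Domain₂.commutativeRing D) ∘ z) zs , Extension.generic-extend D zs gen

-- 2 ^ t, in the form given by the concatenations in flatten and coflatten.
dimension : ℕ → ℕ
dimension zero    = 1
dimension (suc t) = dimension t ℕ.+ dimension t

-- The coefficient pairing as a dot product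

module Flatten (D : Domain₂) where
  open Domain₂ D
  open SquareFree D
  open Elimination D

  flatten : ∀ {t} → Poly t → Vector Carrier (dimension t)
  flatten {zero}  U _ = U []
  flatten {suc t} U = flatten (U ∘ (false ∷_)) ++ flatten (U ∘ (true ∷_))

  -- The halves are swapped relative to `flatten`, so that the coordinate of each exponent vector
  -- meets that of its complement.
  coflatten : ∀ {t} → Poly t → Vector Carrier (dimension t)
  coflatten {zero}  U _ = U []
  coflatten {suc t} U = coflatten (U ∘ (true ∷_)) ++ coflatten (U ∘ (false ∷_))

  dot-++ : ∀ {m n} (u u′ : Vector Carrier m) (v v′ : Vector Carrier n) →
    dot (u ++ v) (u′ ++ v′) ≈ dot u u′ + dot v v′
  dot-++ {zero}  u u′ v v′ = sym (+-identityˡ _)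
  dot-++ {suc m} u u′ v v′ = trans (+-congˡ (trans (dot-cong (tail-++ u v) (tail-++ u′ v′)) (dot-++ (u ∘ Fin.suc) (u′ ∘ Fin.suc) v v′))) (sym (+-assoc _ _ _))
    where
    open CommutativeMonoidSum +-commutativeMonoid using (sum-cong-≋)
    dot-cong : ∀ {N} {u u′ g g′ : Vector Carrier N} → (∀ i → u i ≡ u′ i) → (∀ i → g i ≡ g′ i) → dot u g ≈ dot u′ g′
    dot-cong equ eqg = sum-cong-≋ λ i → *-cong (reflexive (equ i)) (reflexive (eqg i))
    tail-++ : ∀ {m n} (u : Vector Carrier (suc m)) (v : Vector Carrier n) i → (u ++ v) (Fin.suc i) ≡ ((u ∘ Fin.suc) ++ v) i
    tail-++ {m} u v i with Fin.splitAt m i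
    ... | inj₁ _ = ≡.refl
    ... | inj₂ _ = ≡.refl

  dot-flatten : ∀ {t} (U V : Poly t) → dot (flatten U) (coflatten V) ≈ ⟨ U , V ⟩
  dot-flatten {zero}  U V = +-identityʳ _
  dot-flatten {suc t} U V = trans
    (dot-++ (flatten (U ∘ (false ∷_))) (coflatten (V ∘ (true ∷_))) (flatten (U ∘ (true ∷_))) (coflatten (V ∘ (false ∷_))))
    (+-cong (dot-flatten (U ∘ (false ∷_)) (V ∘ (true ∷_))) (dot-flatten (U ∘ (true ∷_)) (V ∘ (false ∷_))))

-- Skew systems of pairs of bit strings

hamming-refl : ∀ {n} (a : Vec Bool n) → hamming a a ≡ 0
hamming-refl [] = ≡.refl
hamming-refl (true ∷ a) = hamming-refl a
hamming-refl (false ∷ a) = hamming-refl a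

hamming-sym : ∀ {n} (a b : Vec Bool n) → hamming a b ≡ hamming b a
hamming-sym [] [] = ≡.refl
hamming-sym (x ∷ a) (y ∷ b) = ≡.cong₂ ℕ._+_ (differ-sym x y) (hamming-sym a b)
  where
  differ-sym : ∀ x y → differ x y ≡ differ y x
  differ-sym true true = ≡.refl
  differ-sym true false = ≡.refl
  differ-sym false true = ≡.refl
  differ-sym false false = ≡.refl

hamming-xor : ∀ {n} (a b : Vec Bool n) → hamming a b ≡ ∣ zipWith _xor_ a b ∣
hamming-xor [] [] = ≡.refl
hamming-xor (false ∷ a) (false ∷ b) = hamming-xor a b
hamming-xor (false ∷ a) (true ∷ b)  = ≡.cong suc (hamming-xor a b)
hamming-xor (true ∷ a)  (false ∷ b) = ≡.cong suc (hamming-xor a b)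
hamming-xor (true ∷ a)  (true ∷ b)  = hamming-xor a b

∣replicate-true∣ : ∀ t → ∣ replicate t true ∣ ≡ t
∣replicate-true∣ zero    = ≡.refl
∣replicate-true∣ (suc t) = ≡.cong suc (∣replicate-true∣ t)

-- The vectors of the u(a) and u(b) form a triangular system: diagonal entries are nonzero by
-- genericity, and the entries against later pairs vanish because the product has degree below `t`.
skew-length : ∀ t {n} (L : List (Vec Bool n × Vec Bool n)) →
  All (λ (a , b) → t ≤ hamming a b) L → AllPairs (λ (a , _) (_ , b) → hamming a b < t) L →
  length L ≤ dimension t
skew-length t {n} L far near = ≡.subst (_≤ dimension t) (length-map vectors L)
  (triangular-length (List.map vectors L)
    (All.map⁺ (All.map (λ {(a , b)} t≤ → nonzero a b t≤) far) ,
     AllPairs.map⁺ (AllPairs.map (λ {p} {q} <t → zeros (proj₁ p) (proj₂ q) <t) near)))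
  where
  D = proj₁ (generic n)
  zs = proj₁ (proj₂ (generic n))
  open Domain₂ D
  open SquareFree D
  open Elimination D
  open Flatten D
  u : Vec Bool n → Poly t
  u a = product zs a one
  vectors : Vec Bool n × Vec Bool n → Vector Carrier (dimension t) × Vector Carrier (dimension t)
  vectors (a , b) = flatten (u a) , coflatten (u b)
  full : Vec Bool t
  full = replicate t true
  pairing : ∀ a b → dot (flatten (u a)) (coflatten (u b)) ≈ product zs (zipWith _xor_ a b) one full
  pairing a b = trans (dot-flatten (u a) (u b)) (trans (product-adjoint zs a b (one {t}) one) (⟨⟩-one (product zs (zipWith _xor_ a b) (one {t}))))
  nonzero : ∀ a b → t ≤ hamming a b → ¬ dot (flatten (u a)) (coflatten (u b)) ≈ 0#
  nonzero a b t≤ ≈0 = proj₂ (proj₂ (generic n)) (zipWith _xor_ a b) full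
    (≡.subst₂ _≤_ (≡.sym (∣replicate-true∣ t)) (hamming-xor a b) t≤) (trans (sym (pairing a b)) ≈0)
  zeros : ∀ a b → hamming a b < t → dot (flatten (u a)) (coflatten (u b)) ≈ 0#
  zeros a b <t = trans (pairing a b) (product-degree zs (zipWith _xor_ a b) full
    (≡.subst₂ _<_ (hamming-xor a b) (≡.sym (∣replicate-true∣ t)) <t))

module _ {A : Set} (dist : A → A → ℕ) (r : ℕ) where

  -- (v , w): the vertex v is picked because of its conflict with w.
  PickSequence : List (A × A) → Set
  PickSequence ps =
    All (λ (v , w) → r < dist v w) ps ×
    AllPairs (λ (v , w) (v′ , w′) → dist v v′ ≤ r × dist v w′ ≤ r) ps

-- The sequence (v₁,w₁),…,(v_k,w_k),(w_k,v_k),…,(w₁,v₁).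
doubled : ∀ {A : Set} → List (A × A) → List (A × A)
doubled []             = []
doubled ((v , w) ∷ ps) = (v , w) ∷ doubled ps List.++ (w , v) ∷ []

length-doubled : ∀ {A : Set} (ps : List (A × A)) → length (doubled ps) ≡ length ps ℕ.+ length ps
length-doubled [] = ≡.refl
length-doubled (p ∷ ps) = ≡.cong suc (≡.trans (length-++ (doubled ps))
  (≡.trans (ℕ.+-comm _ 1) (≡.trans (≡.cong suc (length-doubled ps)) (≡.sym (ℕ.+-suc (length ps) (length ps))))))

doubled-all : ∀ {A : Set} {P : A × A → Set} ps → All (λ (v , w) → P (v , w) × P (w , v)) ps → All P (doubled ps)
doubled-all [] [] = []
doubled-all (_ ∷ ps) ((p , q) ∷ all) = p ∷ All.++⁺ (doubled-all ps all) (q ∷ [])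

-- The pair `(v , w)` comes first and `(w , v)` last, so `w` is compared with nothing, and `v` only
-- with itself and with both members of later picks.
doubled-skew : ∀ {A : Set} {dist : A → A → ℕ} {r} → (∀ a → dist a a ≤ r) → (∀ a b → dist a b ≡ dist b a) →
  ∀ ps → AllPairs (λ (v , w) (v′ , w′) → dist v v′ ≤ r × dist v w′ ≤ r) ps →
  AllPairs (λ (a , _) (_ , b) → dist a b ≤ r) (doubled ps)
doubled-skew dist-refl dist-sym [] [] = []
doubled-skew {dist = dist} {r} dist-refl dist-sym ((v , w) ∷ ps) (close ∷ pairs) =
  All.++⁺ (doubled-all ps (All.map (λ (vv , vw) → vw , vv) close)) (dist-refl v ∷ []) ∷
  AllPairs.++⁺ (doubled-skew dist-refl dist-sym ps pairs) ([] ∷ [])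
    (All.map (_∷ []) (doubled-all ps (All.map (λ (vv , vw) → flip vv , flip vw) close)))
  where
  flip : ∀ {x} → dist v x ≤ r → dist x v ≤ r
  flip {x} = ≡.subst (_≤ r) (dist-sym v x)

pickSequence-length : ∀ {n} r (ps : List (Vec Bool n × Vec Bool n)) → PickSequence hamming r ps →
  length ps ℕ.+ length ps ≤ dimension (suc r)
pickSequence-length r ps (far , close) = ≡.subst (_≤ dimension (suc r)) (length-doubled ps)
  (skew-length (suc r) (doubled ps)
    (doubled-all ps (All.map (λ {(v , w)} <r → <r , ≡.subst (r <_) (hamming-sym v w) <r) far))
    (AllPairs.map s≤s (doubled-skew (λ a → ℕ.≤-trans (ℕ.≤-reflexive (hamming-refl a)) z≤n) hamming-sym ps close)))

-- Collapses along a sequence of picks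

open import Data.Nat using (_+_; _*_; _∸_; _^_; _/_)
open ≡ using (refl; sym; trans; cong; cong₂; subst; ≢-sym)

∣p∪q∣≤∣p∣+∣q∣ : ∀ {m} (p q : Subset m) → ∣ p ∪ q ∣ ≤ ∣ p ∣ + ∣ q ∣
∣p∪q∣≤∣p∣+∣q∣ [] [] = z≤n
∣p∪q∣≤∣p∣+∣q∣ (true ∷ p) (false ∷ q) = s≤s (∣p∪q∣≤∣p∣+∣q∣ p q)
∣p∪q∣≤∣p∣+∣q∣ (true ∷ p) (true ∷ q) =
  s≤s (ℕ.≤-trans (∣p∪q∣≤∣p∣+∣q∣ p q) (ℕ.+-monoʳ-≤ ∣ p ∣ (ℕ.n≤1+n ∣ q ∣)))
∣p∪q∣≤∣p∣+∣q∣ (false ∷ p) (true ∷ q) =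
  ℕ.≤-trans (s≤s (∣p∪q∣≤∣p∣+∣q∣ p q)) (ℕ.≤-reflexive (sym (ℕ.+-suc ∣ p ∣ ∣ q ∣)))
∣p∪q∣≤∣p∣+∣q∣ (false ∷ p) (false ∷ q) = ∣p∪q∣≤∣p∣+∣q∣ p q

x∉p-x : ∀ {m} (p : Subset m) (x : Fin m) → x ∉ p - x
x∉p-x (_ ∷ p) Fin.zero ()
x∉p-x (_ ∷ p) (Fin.suc x) (Vec.there i) = x∉p-x p x i

module _ {m : ℕ} (dist : Fin m → Fin m → ℕ) (r d : ℕ)
  (dist-refl : ∀ i → dist i i ≤ r)
  (dist-sym : ∀ i j → dist i j ≡ dist j i)
  (bound : ∀ ps → PickSequence dist r ps → length ps ≤ d)
  where

  private
    Δ : Complex m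
    Δ = VR dist r

  neighbours : Fin m → Subset m
  neighbours v = tabulate (λ j → does (dist v j ≤? r))

  ∈-neighbours⁺ : ∀ {v j} → dist v j ≤ r → j ∈ neighbours v
  ∈-neighbours⁺ {v} {j} p =
    lookup⇒[]= j _ (trans (lookup∘tabulate _ j) (dec-true (dist v j ≤? r) p))

  ∈-neighbours⁻ : ∀ {v j} → j ∈ neighbours v → dist v j ≤ r
  ∈-neighbours⁻ {v} {j} j∈ = fromDoes (dist v j ≤? r) (trans (sym (lookup∘tabulate _ j)) ([]=⇒lookup j∈))
    where
    fromDoes : (q : Dec (dist v j ≤ r)) → does q ≡ true → dist v j ≤ r
    fromDoes (yes p) _ = p

  Conflict : Subset m → Fin m → Fin m → Set
  Conflict R v w = v ∈ R × w ∈ R × r < dist v w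

  conflict? : ∀ R → Dec (∃₂ (Conflict R))
  conflict? R = any? λ v → any? λ w → (v ∈? R) ×-dec ((w ∈? R) ×-dec (suc r ≤? dist v w))

  -- The part of the complex that one recursive call removes.
  Block : Subset m → Subset m → Complex m
  Block S R τ = S ⊆ τ × τ ⊆ S ∪ R × Δ τ

  -- `S` holds the picks whose links were entered, `R` the vertices still available. By `picked`,
  -- any conflict within `R` extends `ps` to a longer pick sequence.
  record State (ps : List (Fin m × Fin m)) (S R : Subset m) : Set where
    field
      picks      : PickSequence dist r ps
      size       : ∣ S ∣ ≤ length ps
      face       : Δ S
      compatible : ∀ s x → s ∈ S → x ∈ R → dist s x ≤ r
      picked     : All (λ (v , _) → ∀ x → x ∈ R → dist v x ≤ r) ps

  delete : ∀ {ps S R} v → State ps S R → State ps S (R - v)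
  delete v st = record
    { picks = picks ; size = size ; face = face
    ; compatible = λ s x s∈ x∈ → compatible s x s∈ (p─q⊆p _ _ x∈)
    ; picked = All.map (λ f x x∈ → f x (p─q⊆p _ _ x∈)) picked }
    where open State st

  pick : ∀ {ps S R v w} → Conflict R v w → State ps S R →
         State (ps List.++ (v , w) ∷ []) (S ∪ ⁅ v ⁆) ((R - v) ∩ neighbours v)
  pick {ps} {S} {R} {v} {w} (v∈R , w∈R , far) st = record
    { picks = All.++⁺ (proj₁ picks) (far ∷ []) ,
              AllPairs.++⁺ (proj₂ picks) ([] ∷ [])
                (All.map (λ f → (f v v∈R , f w w∈R) ∷ []) picked)
    ; size = ℕ.≤-trans (∣p∪q∣≤∣p∣+∣q∣ S ⁅ v ⁆)
        (ℕ.≤-trans (ℕ.+-mono-≤ size (ℕ.≤-reflexive (∣⁅x⁆∣≡1 v)))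
                   (ℕ.≤-reflexive (sym (length-++ ps))))
    ; face = λ i j i∈ j∈ → joinFace i j (x∈p∪q⁻ S ⁅ v ⁆ i∈) (x∈p∪q⁻ S ⁅ v ⁆ j∈)
    ; compatible = λ s x s∈ x∈ → joinCompatible s x (x∈p∪q⁻ S ⁅ v ⁆ s∈) (x∈p∩q⁻ _ _ x∈)
    ; picked = All.++⁺ (All.map (λ f x x∈ → f x (restrict x∈)) picked)
        ((λ x x∈ → ∈-neighbours⁻ (proj₂ (x∈p∩q⁻ _ _ x∈))) ∷ [])
    }
    where
    open State st
    restrict : ∀ {x} → x ∈ (R - v) ∩ neighbours v → x ∈ R
    restrict x∈ = p─q⊆p R _ (proj₁ (x∈p∩q⁻ _ _ x∈))
    joinFace : ∀ i j → i ∈ S ⊎ i ∈ ⁅ v ⁆ → j ∈ S ⊎ j ∈ ⁅ v ⁆ → dist i j ≤ r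
    joinFace i j (inj₁ i∈) (inj₁ j∈) = face i j i∈ j∈
    joinFace i j (inj₁ i∈) (inj₂ j∈) with refl ← x∈⁅y⁆⇒x≡y v j∈ = compatible i v i∈ v∈R
    joinFace i j (inj₂ i∈) (inj₁ j∈) with refl ← x∈⁅y⁆⇒x≡y v i∈ =
      subst (_≤ r) (dist-sym j v) (compatible j v j∈ v∈R)
    joinFace i j (inj₂ i∈) (inj₂ j∈) with refl ← x∈⁅y⁆⇒x≡y v i∈ | refl ← x∈⁅y⁆⇒x≡y v j∈ = dist-refl v
    joinCompatible : ∀ s x → s ∈ S ⊎ s ∈ ⁅ v ⁆ → x ∈ R - v × x ∈ neighbours v → dist s x ≤ r
    joinCompatible s x (inj₁ s∈) (x∈R , _) = compatible s x s∈ (p─q⊆p R _ x∈R)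
    joinCompatible s x (inj₂ s∈) (_ , x∈N) with refl ← x∈⁅y⁆⇒x≡y v s∈ = ∈-neighbours⁻ x∈N

  -- The faces of Γ containing S are exactly those of Block S R, so a face
  -- pair of the link of S in Γ lifts to a face pair of Γ.
  record Located (Γ : Complex m) (S R : Subset m) : Set where
    field
      inside  : ∀ τ → Γ τ → Δ τ
      covers  : ∀ τ → Block S R τ → Γ τ
      bounded : ∀ τ → Γ τ → S ⊆ τ → τ ⊆ S ∪ R

  -- A pointwise equivalence, because removing the link and then the deletion yields a different
  -- predicate from removing the block at once.
  Minus : Complex m → Complex m → Complex m → Set
  Minus Γ B Γ′ = ∀ τ → Γ′ τ ⇔ (Γ τ × ¬ B τ)

  open Equivalence using (to; from)

  -- The collapses that remain afterwards are passed as a continuation, which chains those of the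
  -- link and of the deletion. `k` bounds the size of `R`, which loses `v` in both recursive calls.
  collapseBlock : ∀ k {ps S R} → ∣ R ∣ ≤ k → State ps S R → ∀ {Γ} → Located Γ S R →
    (∀ {Γ′} → Minus Γ (Block S R) Γ′ → Collapsible d Γ′) → Collapsible d Γ
  collapseBlock k {ps} {S} {R} R≤k st {Γ} loc continue with conflict? R
  ... | no ¬conflict =
    -- Without conflicts `S ∪ R` is itself a face, and by `bounded` it contains every face above
    -- `S`.
    step S (S ∪ R) (covers S ((λ x → x) , p⊆p∪q R , face))
      (ℕ.≤-trans size (bound ps picks))
      (p⊆p∪q R , (covers (S ∪ R) (p⊆p∪q R , (λ x → x) , top) , maximal) , unique)
      (continue λ τ → mk⇔
        (λ (τ∈ , ∉) → τ∈ , λ (S⊆ , ⊆S∪R , _) → ∉ ((λ {x} → S⊆ {x}) , (λ {x} → ⊆S∪R {x})))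
        (λ (τ∈ , ∉) → τ∈ , λ (S⊆ , ⊆S∪R) → ∉ ((λ {x} → S⊆ {x}) , (λ {x} → ⊆S∪R {x}) , inside τ τ∈)))
    where
    open State st
    open Located loc
    joined : ∀ i j → i ∈ S ⊎ i ∈ R → j ∈ S ⊎ j ∈ R → dist i j ≤ r
    joined i j (inj₁ i∈) (inj₁ j∈) = face i j i∈ j∈
    joined i j (inj₁ i∈) (inj₂ j∈) = compatible i j i∈ j∈
    joined i j (inj₂ i∈) (inj₁ j∈) = subst (_≤ r) (dist-sym j i) (compatible j i j∈ i∈)
    joined i j (inj₂ i∈) (inj₂ j∈) = ℕ.≮⇒≥ λ far → ¬conflict (i , j , i∈ , j∈ , far)
    top : Δ (S ∪ R)
    top i j i∈ j∈ = joined i j (x∈p∪q⁻ S R i∈) (x∈p∪q⁻ S R j∈)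
    maximal : ∀ τ → Γ τ → S ∪ R ⊆ τ → τ ≡ S ∪ R
    maximal τ τ∈ ⊆τ = ⊆-antisym (bounded τ τ∈ (λ x → ⊆τ (p⊆p∪q R x))) ⊆τ
    unique : ∀ σ → IsMaximalFace Γ σ → S ⊆ σ → σ ≡ S ∪ R
    unique σ (σ∈ , σmax) S⊆σ =
      sym (σmax (S ∪ R) (covers (S ∪ R) (p⊆p∪q R , (λ x → x) , top)) (bounded σ σ∈ S⊆σ))
  collapseBlock zero R≤0 st loc continue | yes (v , w , v∈R , _) =
    contradiction (ℕ.<-≤-trans (x∈p⇒∣p-x∣<∣p∣ v∈R) R≤0) ℕ.n≮0
  collapseBlock (suc k) {ps} {S} {R} R≤k st {Γ} loc continue | yes (v , w , c@(v∈R , w∈R , far)) =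
    -- The faces containing `v` go first; the remaining faces above `S` then lie in `S ∪ (R - v)`,
    -- as the call for the deletion requires.
    collapseBlock k (ℕ.≤-trans (p⊆q⇒∣p∣≤∣q∣ (p∩q⊆p (R - v) _)) smaller) (pick c st) locLink
      λ {Γ₁} minus₁ →
    collapseBlock k smaller (delete v st) (locDeletion minus₁)
      λ {Γ₂} minus₂ → continue (union minus₁ minus₂)
    where
    open Located loc
    smaller : ∣ R - v ∣ ≤ k
    smaller = ℕ.≤-pred (ℕ.≤-trans (x∈p⇒∣p-x∣<∣p∣ v∈R) R≤k)

    S′ R′ : Subset m
    S′ = S ∪ ⁅ v ⁆
    R′ = (R - v) ∩ neighbours v

    v∈S′ : v ∈ S′
    v∈S′ = q⊆p∪q S ⁅ v ⁆ (x∈⁅x⁆ v)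

    link⊆ : S′ ∪ R′ ⊆ S ∪ R
    link⊆ x∈ with x∈p∪q⁻ S′ R′ x∈
    ... | inj₂ x∈R′ = q⊆p∪q S R (p─q⊆p R _ (proj₁ (x∈p∩q⁻ _ _ x∈R′)))
    ... | inj₁ x∈S′ with x∈p∪q⁻ S ⁅ v ⁆ x∈S′
    ... | inj₁ x∈S = p⊆p∪q R x∈S
    ... | inj₂ x∈v with refl ← x∈⁅y⁆⇒x≡y v x∈v = q⊆p∪q S R v∈R

    ⊆link : ∀ {τ} → Δ τ → v ∈ τ → τ ⊆ S ∪ R → τ ⊆ S′ ∪ R′
    ⊆link {τ} τ∈ v∈τ τ⊆ {x} x∈τ with x Fin.≟ v
    ... | yes refl = p⊆p∪q R′ v∈S′
    ... | no x≢v with x∈p∪q⁻ S R (τ⊆ x∈τ)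
    ... | inj₁ x∈S = p⊆p∪q R′ (p⊆p∪q ⁅ v ⁆ x∈S)
    ... | inj₂ x∈R = q⊆p∪q S′ R′ (x∈p∩q⁺ (x∈p∧x≢y⇒x∈p-y x∈R x≢v , ∈-neighbours⁺ (τ∈ v x v∈τ x∈τ)))

    S′⊆ : ∀ {τ} → S ⊆ τ → v ∈ τ → S′ ⊆ τ
    S′⊆ S⊆τ v∈τ x∈ with x∈p∪q⁻ S ⁅ v ⁆ x∈
    ... | inj₁ x∈S = S⊆τ x∈S
    ... | inj₂ x∈v with refl ← x∈⁅y⁆⇒x≡y v x∈v = v∈τ

    ⊆deletion : ∀ {τ} → v ∉ τ → τ ⊆ S ∪ R → τ ⊆ S ∪ (R - v)
    ⊆deletion v∉τ τ⊆ x∈τ with x∈p∪q⁻ S R (τ⊆ x∈τ)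
    ... | inj₁ x∈S = p⊆p∪q _ x∈S
    ... | inj₂ x∈R = q⊆p∪q S _ (x∈p∧x≢y⇒x∈p-y x∈R λ { refl → v∉τ x∈τ })

    deletion⊆ : S ∪ (R - v) ⊆ S ∪ R
    deletion⊆ x∈ with x∈p∪q⁻ S (R - v) x∈
    ... | inj₁ x∈S = p⊆p∪q R x∈S
    ... | inj₂ x∈R = q⊆p∪q S R (p─q⊆p R _ x∈R)

    -- The conflict keeps `v` out of `S`, whose members are all compatible with `w`.
    v∉deletion : v ∉ S ∪ (R - v)
    v∉deletion v∈ with x∈p∪q⁻ S (R - v) v∈
    ... | inj₁ v∈S = ℕ.<⇒≱ far (State.compatible st v w v∈S w∈R)
    ... | inj₂ v∈R-v = x∉p-x R v v∈R-v

    linkBlock : ∀ {τ} → Block S′ R′ τ → Block S R τ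
    linkBlock (S′⊆τ , τ⊆ , τ∈) = (λ x → S′⊆τ (p⊆p∪q _ x)) , (λ x → link⊆ (τ⊆ x)) , τ∈

    deletionBlock : ∀ {τ} → Block S (R - v) τ → Block S R τ
    deletionBlock (S⊆τ , τ⊆ , τ∈) = (λ x → S⊆τ x) , (λ x → deletion⊆ (τ⊆ x)) , τ∈

    locLink : Located Γ S′ R′
    locLink = record
      { inside = inside
      ; covers = λ τ b → covers τ (linkBlock b)
      ; bounded = λ τ τ∈ S′⊆τ → ⊆link (inside τ τ∈) (S′⊆τ v∈S′) (bounded τ τ∈ λ x → S′⊆τ (p⊆p∪q _ x)) }

    locDeletion : ∀ {Γ₁} → Minus Γ (Block S′ R′) Γ₁ → Located Γ₁ S (R - v)
    locDeletion minus = record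
      { inside = λ τ τ∈ → inside τ (proj₁ (to (minus τ) τ∈))
      ; covers = λ τ b → from (minus τ) (covers τ (deletionBlock b) ,
          λ (S′⊆τ , _) → v∉deletion (proj₁ (proj₂ b) (S′⊆τ v∈S′)))
      ; bounded = λ τ τ∈ S⊆τ → let Γτ , ∉link = to (minus τ) τ∈ ; τ⊆ = bounded τ Γτ (λ {x} → S⊆τ {x}) in
          ⊆deletion (λ v∈τ → ∉link (S′⊆ S⊆τ v∈τ , ⊆link (inside τ Γτ) v∈τ τ⊆ , inside τ Γτ)) τ⊆ }

    union : ∀ {Γ₁ Γ₂} → Minus Γ (Block S′ R′) Γ₁ → Minus Γ₁ (Block S (R - v)) Γ₂ → Minus Γ (Block S R) Γ₂
    union minus₁ minus₂ τ = mk⇔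
      (λ τ∈₂ → let τ∈₁ , ∉deletion = to (minus₂ τ) τ∈₂ ; τ∈ , ∉link = to (minus₁ τ) τ∈₁ in
        τ∈ , λ (S⊆τ , τ⊆ , Δτ) → case v ∈? τ of λ where
          (yes v∈τ) → ∉link (S′⊆ S⊆τ v∈τ , ⊆link Δτ v∈τ τ⊆ , Δτ)
          (no v∉τ) → ∉deletion ((λ {x} → S⊆τ {x}) , ⊆deletion v∉τ τ⊆ , Δτ))
      (λ (τ∈ , ∉) → from (minus₂ τ) (from (minus₁ τ) (τ∈ , ∉ ∘ linkBlock) , ∉ ∘ deletionBlock))

  VR-collapsible : Collapsible d Δ
  -- The block over the empty face with all vertices available is the whole complex, so what is left
  -- is void.
  VR-collapsible = collapseBlock ∣ ⊤ {m} ∣ {S = ⊥} {R = ⊤} ℕ.≤-refl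
    (record { picks = [] , [] ; size = ℕ.≤-reflexive (∣⊥∣≡0 m) ; face = λ _ _ i∈ → contradiction i∈ ∉⊥
            ; compatible = λ _ _ s∈ → contradiction s∈ ∉⊥ ; picked = [] })
    (record { inside = λ _ τ∈ → τ∈ ; covers = λ _ (_ , _ , τ∈) → τ∈
            ; bounded = λ _ _ _ _ → q⊆p∪q ⊥ ⊤ ∈⊤ })
    λ minus → done λ τ τ∈ → let Δτ , ∉ = to (minus τ) τ∈ in
      ∉ ((λ x∈ → contradiction x∈ ∉⊥) , (λ _ → q⊆p∪q ⊥ ⊤ ∈⊤) , Δτ)

-- Cross-polytopes obstruct collapses

unique-length≤∣p∣ : ∀ {m} {xs : List (Fin m)} {p : Subset m} →
  Unique xs → All (_∈ p) xs → length xs ≤ ∣ p ∣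
unique-length≤∣p∣ [] [] = z≤n
unique-length≤∣p∣ (x≢ ∷ uniq) (x∈ ∷ xs∈) = ℕ.<-≤-trans
  (s≤s (unique-length≤∣p∣ uniq (All.zipWith (λ (x≢y , y∈) → x∈p∧x≢y⇒x∈p-y y∈ (≢-sym x≢y)) (x≢ , xs∈))))
  (x∈p⇒∣p-x∣<∣p∣ x∈)

-- Keep enlarging the face; whether a larger one exists is decided only under double negation, as
-- `Γ` is an arbitrary predicate.
¬¬-maximal : ∀ {m} (Γ : Complex m) τ → Γ τ → ¬ ¬ (∃ λ σ → IsMaximalFace Γ σ × τ ⊆ σ)
¬¬-maximal Γ τ = go τ (⊃-wellFounded τ)
  where
  go : ∀ τ → Acc _⊃_ τ → Γ τ → ¬ ¬ (∃ λ σ → IsMaximalFace Γ σ × τ ⊆ σ)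
  go τ (acc rec) τ∈ none = ¬¬-excluded-middle {A = ∃ λ τ′ → Γ τ′ × τ ⊂ τ′} λ where
    (yes (τ′ , τ′∈ , τ⊂τ′@(τ⊆τ′ , _))) →
      go τ′ (rec τ⊂τ′) τ′∈ λ (σ , σmax , τ′⊆σ) → none (σ , σmax , λ x∈ → τ′⊆σ (τ⊆τ′ x∈))
    (no ¬larger) → none (τ , (τ∈ , λ τ′ τ′∈ τ⊆τ′ →
      ⊆-antisym (λ {x} x∈ → decidable-stable (x ∈? τ) λ x∉ → ¬larger (τ′ , τ′∈ , τ⊆τ′ , x , x∈ , x∉)) τ⊆τ′) , λ x∈ → x∈)

module _ {m : ℕ} (dist : Fin m → Fin m → ℕ) (r c : ℕ)
  (dist-refl : ∀ i → dist i i ≤ r)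
  (dist-sym : ∀ i j → dist i j ≡ dist j i)
  (e : Fin c → Bool → Fin m)
  (far : ∀ k → r < dist (e k true) (e k false))
  (near : ∀ k l b b′ → e l b′ ≡ e k (not b) ⊎ dist (e k b) (e l b′) ≤ r)
  (e-injective : ∀ k l b b′ → e k b ≡ e l b′ → k ≡ l)
  where

  private
    Core : Fin m → Set
    Core x = ∃ λ k → x ≡ e k true ⊎ x ≡ e k false

    core? : ∀ x → Dec (Core x)
    core? x = any? λ k → (x Fin.≟ e k true) ⊎-dec (x Fin.≟ e k false)

    core⁻ : ∀ {x} → Core x → ∃ λ k → ∃ λ b → x ≡ e k b
    core⁻ (k , inj₁ eq) = k , true , eq
    core⁻ (k , inj₂ eq) = k , false , eq

    core⁺ : ∀ k b → Core (e k b)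
    core⁺ k true  = k , inj₁ refl
    core⁺ k false = k , inj₂ refl

  -- Otherwise a point of `γ` chosen from each pair gives `c` distinct members of `γ`.
  missed-pair : ∀ γ → ∣ γ ∣ < c → ∃ λ k → e k true ∉ γ × e k false ∉ γ
  missed-pair γ small with any? (λ k → ¬? (e k true ∈? γ) ×-dec ¬? (e k false ∈? γ))
  ... | yes found = found
  ... | no none = contradiction
    (subst (_≤ ∣ γ ∣) (length-tabulate g)
      (unique-length≤∣p∣ (Unique.tabulate⁺ g-injective) (All.tabulate⁺ (λ k → proj₂ (meets k)))))
    (ℕ.<⇒≱ small)
    where
    meets : ∀ k → ∃ λ b → e k b ∈ γ
    meets k with e k true ∈? γ | e k false ∈? γ
    ... | yes t∈ | _ = true , t∈
    ... | no _ | yes f∈ = false , f∈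
    ... | no t∉ | no f∉ = contradiction (k , t∉ , f∉) none
    g : Fin c → Fin m
    g k = e k (proj₁ (meets k))
    g-injective : ∀ {k l} → g k ≡ g l → k ≡ l
    g-injective = e-injective _ _ _ _

  -- A collapse at a face γ on the cross-polytope with fewer than c vertices is impossible:
  -- γ misses some antipodal pair, and each point of the pair can be added to γ, so the
  -- unique maximal face containing γ would contain both.
  crossPolytope-bound : ∀ d {Γ : Complex m} → Collapsible d Γ → (∀ τ → Γ τ → VR dist r τ) →
    (∀ τ → (∀ x → x ∈ τ → Core x) → VR dist r τ → Γ τ) → c ≤ d
  -- The empty face survives, so the complex is not void.
  crossPolytope-bound d (done void) inside survive =
    contradiction (survive ⊥ (λ _ x∈ → contradiction x∈ ∉⊥) (λ _ _ i∈ → contradiction i∈ ∉⊥)) (void ⊥)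
  crossPolytope-bound d {Γ} (step γ σ γ∈ γ≤d (γ⊆σ , (σ∈ , _) , unique) rest) inside survive
    with any? (λ x → (x ∈? γ) ×-dec ¬? (core? x))
  -- Every removed face contains `x`, so the cross-polytope is untouched.
  ... | yes (x , x∈γ , x∉core) = crossPolytope-bound d rest (λ τ τ∈ → inside τ (proj₁ τ∈))
    λ τ core vr → survive τ core vr , λ (γ⊆τ , _) → x∉core (core x (γ⊆τ x∈γ))
  ... | no none = decidable-stable (c ≤? d) λ c≰d →
    let k , t∉ , f∉ = missed-pair γ (ℕ.≤-<-trans γ≤d (ℕ.≰⇒> c≰d)) in
    contains k true f∉ λ t∈σ → contains k false t∉ λ f∈σ →
      ℕ.<⇒≱ (far k) (inside σ σ∈ _ _ t∈σ f∈σ)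
    where
    γcore : ∀ x → x ∈ γ → Core x
    γcore x x∈γ = decidable-stable (core? x) λ x∉core → none (x , x∈γ , x∉core)

    nearγ : ∀ k b → e k (not b) ∉ γ → ∀ x → x ∈ γ → dist (e k b) x ≤ r
    nearγ k b ∉γ x x∈γ with l , b′ , refl ← core⁻ (γcore x x∈γ) with near k l b b′
    ... | inj₁ eq = contradiction (subst (_∈ γ) eq x∈γ) ∉γ
    ... | inj₂ close = close

    contains : ∀ k b → e k (not b) ∉ γ → ¬ ¬ (e k b ∈ σ)
    contains k b ∉γ ∉σ = ¬¬-maximal Γ γ⁺ (survive γ⁺ γ⁺core γ⁺face) λ (σ′ , σ′max , γ⁺⊆σ′) →
      ∉σ (subst (e k b ∈_) (unique σ′ σ′max (λ x∈ → γ⁺⊆σ′ (p⊆p∪q _ x∈))) (γ⁺⊆σ′ (q⊆p∪q γ _ (x∈⁅x⁆ _))))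
      where
      γ⁺ = γ ∪ ⁅ e k b ⁆
      split : ∀ x → x ∈ γ⁺ → x ∈ γ ⊎ x ≡ e k b
      split x x∈ with x∈p∪q⁻ γ _ x∈
      ... | inj₁ x∈γ = inj₁ x∈γ
      ... | inj₂ x∈e = inj₂ (x∈⁅y⁆⇒x≡y _ x∈e)
      γ⁺core : ∀ x → x ∈ γ⁺ → Core x
      γ⁺core x x∈ with split x x∈
      ... | inj₁ x∈γ = γcore x x∈γ
      ... | inj₂ refl = core⁺ k b
      γ⁺face : VR dist r γ⁺
      γ⁺face i j i∈ j∈ with split i i∈ | split j j∈
      ... | inj₁ i∈γ | inj₁ j∈γ = inside γ γ∈ i j i∈γ j∈γ
      ... | inj₂ refl | inj₁ j∈γ = nearγ k b ∉γ j j∈γ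
      ... | inj₁ i∈γ | inj₂ refl = subst (_≤ r) (dist-sym _ i) (nearγ k b ∉γ i i∈γ)
      ... | inj₂ refl | inj₂ refl = dist-refl _

-- Both bounds for the hypercube

hammingℕ : ℕ → ℕ → ℕ → ℕ
hammingℕ n x y = hamming {n} (tabulate (λ i → bit x (toℕ i))) (tabulate (λ i → bit y (toℕ i)))

-- Both numbers have only zero digits from position `k` on.
hammingℕ-extend : ∀ k {n} x y → x < 2 ^ k → y < 2 ^ k → hammingℕ (k + n) x y ≡ hammingℕ k x y
hammingℕ-extend zero {n} zero zero _ _ = hamming-refl {n} (tabulate (λ i → bit 0 (toℕ i)))
hammingℕ-extend zero (suc x) _ (s≤s ()) _
hammingℕ-extend zero zero (suc y) _ (s≤s ())
hammingℕ-extend (suc k) x y x< y< =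
  cong (differ (bit x 0) (bit y 0) +_) (hammingℕ-extend k (x / 2) (y / 2) (half x x<) (half y y<))
  where
  half : ∀ x → x < 2 * 2 ^ k → x / 2 < 2 ^ k
  half x x< = m<n*o⇒m/o<n (subst (x <_) (ℕ.*-comm 2 (2 ^ k)) x<)

-- Subtraction from 15 complements all four binary digits.
antipodal : Fin 8 → Bool → ℕ
antipodal k true = toℕ k
antipodal k false = 15 ∸ toℕ k

antipodal<16 : ∀ k b → antipodal k b < 2 ^ 4
antipodal<16 k true = ℕ.<-trans (toℕ<n k) (ℕ.m≤m+n 9 7)
antipodal<16 k false = s≤s (ℕ.m∸n≤m 15 (toℕ k))

antipodal-far : ∀ k → 3 < hammingℕ 4 (antipodal k true) (antipodal k false)
antipodal-far = from-yes (all? λ k → 3 <? hammingℕ 4 (antipodal k true) (antipodal k false))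

antipodal-near : ∀ k l b b′ → antipodal l b′ ≡ antipodal k (not b) ⊎ hammingℕ 4 (antipodal k b) (antipodal l b′) ≤ 3
antipodal-near k l b b′ = lemma b b′ k l
  where
  near? : ∀ b b′ → Dec (∀ k l → _)
  near? b b′ = all? λ k → all? λ l → (antipodal l b′ ℕ.≟ antipodal k (not b)) ⊎-dec (hammingℕ 4 (antipodal k b) (antipodal l b′) ≤? 3)
  lemma : ∀ b b′ k l → antipodal l b′ ≡ antipodal k (not b) ⊎ hammingℕ 4 (antipodal k b) (antipodal l b′) ≤ 3
  lemma true true = from-yes (near? true true)
  lemma true false = from-yes (near? true false)
  lemma false true = from-yes (near? false true)
  lemma false false = from-yes (near? false false)

antipodal-injective : ∀ k l b b′ → antipodal k b ≡ antipodal l b′ → k ≡ l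
antipodal-injective k l b b′ = lemma b b′ k l
  where
  inj? : ∀ b b′ → Dec (∀ k l → _)
  inj? b b′ = all? λ k → all? λ l → (antipodal k b ℕ.≟ antipodal l b′) →-dec (k Fin.≟ l)
  lemma : ∀ b b′ k l → antipodal k b ≡ antipodal l b′ → k ≡ l
  lemma true true = from-yes (inj? true true)
  lemma true false = from-yes (inj? true false)
  lemma false true = from-yes (inj? false true)
  lemma false false = from-yes (inj? false false)

hypercube-lower : ∀ n d → Collapsible d (VRHypercube (4 + n) 3) → 8 ≤ d
hypercube-lower n d col = crossPolytope-bound (hypercubeDist (4 + n)) 3 8
  (λ i → ℕ.≤-trans (ℕ.≤-reflexive (hamming-refl (toBits (4 + n) i))) z≤n)
  (λ i j → hamming-sym (toBits (4 + n) i) (toBits (4 + n) j))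
  e
  (λ k → subst (3 <_) (sym (dist-e k k true false)) (antipodal-far k))
  near
  (λ k l b b′ eq → antipodal-injective k l b b′ (trans (sym (toℕ-e k b)) (trans (cong toℕ eq) (toℕ-e l b′))))
  d col (λ _ τ∈ → τ∈) (λ _ _ vr → vr)
  where
  16≤ : 2 ^ 4 ≤ 2 ^ (4 + n)
  16≤ = ℕ.^-monoʳ-≤ 2 (ℕ.m≤m+n 4 n)
  e : Fin 8 → Bool → Fin (2 ^ (4 + n))
  e k b = fromℕ< (ℕ.<-≤-trans (antipodal<16 k b) 16≤)
  toℕ-e : ∀ k b → toℕ (e k b) ≡ antipodal k b
  toℕ-e k b = toℕ-fromℕ< _
  dist-e : ∀ k l b b′ → hypercubeDist (4 + n) (e k b) (e l b′) ≡ hammingℕ 4 (antipodal k b) (antipodal l b′)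
  dist-e k l b b′ = trans (cong₂ (hammingℕ (4 + n)) (toℕ-e k b) (toℕ-e l b′))
    (hammingℕ-extend 4 {n} (antipodal k b) (antipodal l b′) (antipodal<16 k b) (antipodal<16 l b′))
  near : ∀ k l b b′ → e l b′ ≡ e k (not b) ⊎ hypercubeDist (4 + n) (e k b) (e l b′) ≤ 3
  near k l b b′ with antipodal-near k l b b′
  ... | inj₁ eq = inj₁ (toℕ-injective (trans (toℕ-e l b′) (trans eq (sym (toℕ-e k (not b))))))
  ... | inj₂ close = inj₂ (subst (_≤ 3) (sym (dist-e k l b b′)) close)

hypercube-upper : ∀ n → Collapsible 8 (VRHypercube n 3)
hypercube-upper n = VR-collapsible (hypercubeDist n) 3 8
  (λ i → ℕ.≤-trans (ℕ.≤-reflexive (hamming-refl (toBits n i))) z≤n)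
  (λ i j → hamming-sym (toBits n i) (toBits n j))
  -- Nine picks would double to 18 pairs, whereas `dimension 4` is 16; `ℕ.m≤n+m 17 1` states 16 <
  -- 18.
  λ ps (far , close) → ℕ.≮⇒≥ λ 9≤ → ℕ.<⇒≱ (ℕ.m≤n+m 17 1)
    (ℕ.≤-trans (ℕ.+-mono-≤ 9≤ 9≤)
      (subst (λ k → k + k ≤ 16) (length-map bits ps)
        (pickSequence-length 3 (List.map bits ps) (All.map⁺ far , AllPairs.map⁺ close))))
  where
  bits : Fin (2 ^ n) × Fin (2 ^ n) → Vec Bool n × Vec Bool n
  bits = map (toBits n) (toBits n)

theorem1p6 : (n : ℕ) → 4 ≤ n → CollapsibilityNumberIs (VRHypercube n 3) 8
theorem1p6 n@.(4 + m) (s≤s (s≤s (s≤s (s≤s {n = m} z≤n)))) = hypercube-upper n , hypercube-lower m
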